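{- Let $W$ be a set of words in the alphabet $\{1,\dots,N\}$, all of the same length. Then $\sum_{\mathsf w\in W}\mathsf w\in I_{\mathrm S}^\perp$ if and only if $W$ is the vertex set of a switchboard.
   Context: $\mathcal U=\mathbb Z\langle u_1,\dots,u_N\rangle$ is the free associative ring on noncommuting generators; $\mathbf u_{\mathsf w}=u_{\mathsf w_1}\cdots u_{\mathsf w_n}$. $\mathcal U^*$ is the free $\mathbb Z$-module on words in $\{1,\dots,N\}$ with pairing $\langle\mathbf u_{\mathsf w},\mathsf v\rangle=\delta_{\mathsf v\mathsf w}$, and $I^\perp=\{\gamma\in\mathcal U^*:\langle z,\gamma\rangle=0\ \forall z\in I\}$. The switchboard ideal $I_{\mathrm S}$ is the two-sided ideal generated by $u_b^2u_a+u_au_bu_a-u_bu_au_b-u_bu_a^2$ ($b-a=1$); $u_b^2u_a-u_bu_au_b$ ($b-a\ge2$); $u_bu_a^2-u_au_bu_a$ ($b-a\ge2$); $u_bu_cu_a+u_au_cu_b-u_bu_au_c-u_cu_au_b$ ($a<b<c$). Two words $\mathsf w,\mathsf w'$ of length $n$ are related by a switch in position $i$ ($2\le i\le n-1$) if $\mathsf w_j=\mathsf w'_j$ for $j\notin\{i-1,i,i+1\}$ and the unordered pair $\{\mathsf w_{i-1}\mathsf w_i\mathsf w_{i+1},\mathsf w'_{i-1}\mathsf w'_i\mathsf w'_{i+1}\}$ has one of the forms: $\{bac,bca\}$ or $\{acb,cab\}$ with $a<b<c$ (Knuth switch); $\{bac,acb\}$ or $\{bca,cab\}$ with $a<b<c$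 (rotation switch); $\{bab,bba\}$ or $\{aba,baa\}$ with $a<b$ (Knuth switch); $\{bab,aba\}$ or $\{bba,baa\}$ with $b=a+1$ (braid/idempotent switch). A switchboard is an edge-labeled graph whose vertex set is a set of words of a fixed length $n$ in $\{1,\dots,N\}$, with edge labels in $\{2,\dots,n-1\}$, such that each edge labeled $i$ joins two words related by a switch in position $i$, and each vertex $\mathsf w$ for which exactly one of $i-1,i$ is a descent (a descent is a position $p$ with $\mathsf w_p>\mathsf w_{p+1}$) belongs to exactly one edge labeled $i$. -}

module Defs where

open import Data.Nat using (ℕ; zero; suc; _+_; _≤_; _<_)
open import Data.Integer as ℤ using (ℤ; 0ℤ; 1ℤ)
open import Data.Fin using (Fin; toℕ; _≟_)
open import Data.List using (List; []; _∷_; _++_; length; map; concatMap; foldr)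
open import Data.List.Properties using (≡-dec)
open import Data.Bool using (Bool; true; false; if_then_else_)
open import Data.Product using (Σ; ∃; ∃-syntax; ∃!; _×_; _,_)
open import Data.Sum using (_⊎_)
open import Relation.Nullary using (¬_; yes; no)
open import Relation.Binary.PropositionalEquality using (_≡_)

-- Letters of the alphabet {1,…,N} are represented by Fin N (shifted by one;
-- the order is that of toℕ, so all order conditions are preserved).
Letter : ℕ → Set
Letter N = Fin N

Word : ℕ → Set
Word N = List (Letter N)

_≟w_ : ∀ {N} (v w : Word N) → Relation.Nullary.Dec (v ≡ w)
_≟w_ = ≡-dec _≟_

-- The free associative ring 𝒰 = ℤ⟨u_1,…,u_N⟩.
-- An element is represented by a finite formal ℤ-linear combination of
-- words (monomials 𝐮_w); two representations denote the same element iff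
-- they have the same coefficient at every word.

Poly : ℕ → Set
Poly N = List (ℤ × Word N)

coeff : ∀ {N} → Poly N → Word N → ℤ
coeff [] v = 0ℤ
coeff ((c , w) ∷ z) v with w ≟w v
... | yes _ = c ℤ.+ coeff z v
... | no  _ = coeff z v

_≈P_ : ∀ {N} → Poly N → Poly N → Set
z ≈P z' = ∀ v → coeff z v ≡ coeff z' v

0P : ∀ {N} → Poly N
0P = []

_+P_ : ∀ {N} → Poly N → Poly N → Poly N
_+P_ = _++_

scaleP : ∀ {N} → ℤ → Poly N → Poly N
scaleP k = map (λ { (c , w) → (k ℤ.* c , w) })

_*P_ : ∀ {N} → Poly N → Poly N → Poly N
z *P z' = concatMap (λ { (c , w) → map (λ { (c' , w') → (c ℤ.* c' , w ++ w') }) z' }) z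

pos neg : ∀ {N} → Word N → ℤ × Word N
pos w = (1ℤ , w)
neg w = (ℤ.- 1ℤ , w)

data SGen {N : ℕ} : Poly N → Set where
  gen-adj  : (a b : Letter N) → toℕ b ≡ suc (toℕ a) →
             SGen (pos (b ∷ b ∷ a ∷ []) ∷ pos (a ∷ b ∷ a ∷ []) ∷
                   neg (b ∷ a ∷ b ∷ []) ∷ neg (b ∷ a ∷ a ∷ []) ∷ [])
  gen-far₁ : (a b : Letter N) → 2 + toℕ a ≤ toℕ b →
             SGen (pos (b ∷ b ∷ a ∷ []) ∷ neg (b ∷ a ∷ b ∷ []) ∷ [])
  gen-far₂ : (a b : Letter N) → 2 + toℕ a ≤ toℕ b →
             SGen (pos (b ∷ a ∷ a ∷ []) ∷ neg (a ∷ b ∷ a ∷ []) ∷ [])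
  gen-three : (a b c : Letter N) → toℕ a < toℕ b → toℕ b < toℕ c →
             SGen (pos (b ∷ c ∷ a ∷ []) ∷ pos (a ∷ c ∷ b ∷ []) ∷
                   neg (b ∷ a ∷ c ∷ []) ∷ neg (c ∷ a ∷ b ∷ []) ∷ [])

data InIS {N : ℕ} : Poly N → Set where
  gen   : ∀ {r} → SGen r → InIS r
  zero  : InIS 0P
  add   : ∀ {z z'} → InIS z → InIS z' → InIS (z +P z')
  mulˡ  : ∀ {z} (x : Poly N) → InIS z → InIS (x *P z)
  mulʳ  : ∀ {z} (y : Poly N) → InIS z → InIS (z *P y)
  resp  : ∀ {z z'} → z ≈P z' → InIS z → InIS z'

-- The element Σ_{w ∈ W} w of 𝒰*, for a (finite) set of words W given by a
-- decidable membership predicate, and its pairing with 𝒰.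

indicator : ∀ {N} → (Word N → Bool) → Word N → ℤ
indicator W w = if W w then 1ℤ else 0ℤ

pairSum : ∀ {N} → Poly N → (Word N → Bool) → ℤ
pairSum [] W = 0ℤ
pairSum ((c , w) ∷ z) W = c ℤ.* indicator W w ℤ.+ pairSum z W

SumInISPerp : ∀ {N} → (Word N → Bool) → Set
SumInISPerp {N} W = ∀ (z : Poly N) → InIS z → pairSum z W ≡ 0ℤ

-- One orientation of each unordered pair of triples allowed by a switch.
data SwitchPair {N : ℕ} : Word N → Word N → Set where
  knuth₁ : ∀ a b c → toℕ a < toℕ b → toℕ b < toℕ c →
           SwitchPair (b ∷ a ∷ c ∷ []) (b ∷ c ∷ a ∷ [])
  knuth₂ : ∀ a b c → toℕ a < toℕ b → toℕ b < toℕ c →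
           SwitchPair (a ∷ c ∷ b ∷ []) (c ∷ a ∷ b ∷ [])
  rot₁   : ∀ a b c → toℕ a < toℕ b → toℕ b < toℕ c →
           SwitchPair (b ∷ a ∷ c ∷ []) (a ∷ c ∷ b ∷ [])
  rot₂   : ∀ a b c → toℕ a < toℕ b → toℕ b < toℕ c →
           SwitchPair (b ∷ c ∷ a ∷ []) (c ∷ a ∷ b ∷ [])
  knuth₃ : ∀ a b → toℕ a < toℕ b →
           SwitchPair (b ∷ a ∷ b ∷ []) (b ∷ b ∷ a ∷ [])
  knuth₄ : ∀ a b → toℕ a < toℕ b →
           SwitchPair (a ∷ b ∷ a ∷ []) (b ∷ a ∷ a ∷ [])
  braid  : ∀ a b → toℕ b ≡ suc (toℕ a) →
           SwitchPair (b ∷ a ∷ b ∷ []) (a ∷ b ∷ a ∷ [])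
  idem   : ∀ a b → toℕ b ≡ suc (toℕ a) →
           SwitchPair (b ∷ b ∷ a ∷ []) (b ∷ a ∷ a ∷ [])

SwitchTriple : ∀ {N} → Word N → Word N → Set
SwitchTriple t t' = SwitchPair t t' ⊎ SwitchPair t' t

-- w and w' are related by a switch in position i (positions 1-indexed):
-- they agree outside positions i-1, i, i+1 and the triples there form a switch.
SwitchAt : ∀ {N} → ℕ → Word N → Word N → Set
SwitchAt {N} i w w' =
  Σ (Word N) λ x → Σ (Word N) λ y → Σ (Word N) λ t → Σ (Word N) λ t' →
    (w ≡ x ++ t ++ y) × (w' ≡ x ++ t' ++ y) × (length x + 2 ≡ i) ×
    SwitchTriple t t'

-- p (1-indexed) is a descent of w: w_p > w_{p+1}
Descent : ∀ {N} → Word N → ℕ → Set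
Descent {N} w p =
  Σ (Word N) λ x → Σ (Letter N) λ c → Σ (Letter N) λ d → Σ (Word N) λ y →
    (w ≡ x ++ c ∷ d ∷ y) × (suc (length x) ≡ p) × (toℕ d < toℕ c)

ExactlyOneDescent : ∀ {N} → Word N → ℕ → Set
ExactlyOneDescent w i =
  (Descent w (i Data.Nat.∸ 1) × ¬ Descent w i) ⊎
  (¬ Descent w (i Data.Nat.∸ 1) × Descent w i)

-- Switchboards.  A switchboard with vertex set W (words of length n) is an
-- edge-labelled graph, given by its symmetric edge relation
-- E w w' i  ("there is an edge labelled i joining w and w'").

record IsSwitchboard {N : ℕ} (n : ℕ) (W : Word N → Bool)
                     (E : Word N → Word N → ℕ → Set) : Set where
  field
    edge-vertexˡ : ∀ {w w' i} → E w w' i → W w ≡ true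
    edge-vertexʳ : ∀ {w w' i} → E w w' i → W w' ≡ true
    edge-sym     : ∀ {w w' i} → E w w' i → E w' w i
    label-lo     : ∀ {w w' i} → E w w' i → 2 ≤ i
    label-hi     : ∀ {w w' i} → E w w' i → suc i ≤ n
    edge-switch  : ∀ {w w' i} → E w w' i → SwitchAt i w w'
    exactly-one  : ∀ w i → W w ≡ true → 2 ≤ i → suc i ≤ n →
                   ExactlyOneDescent w i → ∃! _≡_ (λ w' → E w w' i)

IsSwitchboardVertexSet : ∀ {N} → ℕ → (Word N → Bool) → Set₁
IsSwitchboardVertexSet {N} n W =
  Σ (Word N → Word N → ℕ → Set) λ E → IsSwitchboard n W E

-- The pairing is bilinear and ⟨x z y, Σ W⟩ = ⟨z, Σ S⟩ for the slice S = {t : x t y ∈ W}, so Σ W ∈ I_S^⊥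
-- exactly when every slice annihilates every generator.  The generators live on triples: those with
-- exactly one descent form 4-cycles t, Knuth partner, ·, other (rotation, braid or idempotent) partner,
-- on which a generator is the alternating sum, and Knuth pairs {bab, bba}, {aba, baa} with b − a ≥ 2,
-- on which it is the difference.  A set of triples annihilates such a generator iff switches inside the
-- set match it perfectly, and these matchings for all slices, labelled by the position of the triple,
-- are exactly the switchboards on W.
module Submission where

open import Defs
open import Data.Nat as ℕ using (ℕ; zero; suc; _≤_; z≤n; s≤s)
import Data.Nat.Properties as ℕP
open import Data.Integer using (ℤ; 0ℤ; 1ℤ; -1ℤ; _+_; _*_)
import Data.Integer.Properties as ℤP
open import Data.Integer.Tactic.RingSolver using (solve-∀)
open import Data.Fin using (toℕ; _<_; _<?_; _≟_)
import Data.Fin.Properties as FinP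
open import Data.Bool using (Bool; true; false; if_then_else_; _xor_; _∨_)
open import Data.List using (List; []; _∷_; _++_; _∷ʳ_; length; map; foldr; deduplicate)
import Data.List.Properties as ListP
open import Data.List.Membership.Propositional using (_∈_; _∉_)
open import Data.List.Relation.Unary.Any using (here; there)
import Data.List.Relation.Unary.Any.Properties as AnyP
open import Data.List.Relation.Unary.All as All using (All; []; _∷_)
open import Data.List.Relation.Unary.AllPairs using (_∷_)
open import Data.List.Relation.Unary.Unique.Propositional using (Unique)
open import Data.List.Relation.Unary.Unique.DecPropositional.Properties using (deduplicate-!)
open import Data.Product as Product using (Σ; ∃!; _×_; _,_; proj₁; proj₂)
open import Data.Sum as Sum using (_⊎_; inj₁; inj₂; [_,_])
open import Data.Empty using (⊥; ⊥-elim)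
open import Function using (id)
open import Function.Bundles using (_⇔_; mk⇔; Equivalence)
open import Relation.Nullary using (¬_; yes; no; does; contradiction)
open import Relation.Nullary.Decidable using (dec-true; dec-false)
open import Relation.Binary.PropositionalEquality hiding ([_])
open import Relation.Binary.Definitions using (tri<; tri≈; tri>)

-- Pairing with Σ W and slices

module _ {N : ℕ} where

  pair : Poly N → (Word N → ℤ) → ℤ
  pair [] f = 0ℤ
  pair ((c , w) ∷ z) f = c * f w + pair z f

  pairSum≡pair-indicator : ∀ z (W : Word N → Bool) → pairSum z W ≡ pair z (indicator W)
  pairSum≡pair-indicator [] W = refl
  pairSum≡pair-indicator ((c , w) ∷ z) W = cong ((c * indicator W w) +_) (pairSum≡pair-indicator z W)

  pair-singleton : ∀ u f → pair ((1ℤ , u) ∷ []) f ≡ f u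
  pair-singleton u f = trans (ℤP.+-identityʳ (1ℤ * f u)) (ℤP.*-identityˡ (f u))

  pair-++ : ∀ z z' f → pair (z ++ z') f ≡ pair z f + pair z' f
  pair-++ [] z' f = sym (ℤP.+-identityˡ _)
  pair-++ ((c , w) ∷ z) z' f =
    trans (cong ((c * f w) +_) (pair-++ z z' f)) (sym (ℤP.+-assoc (c * f w) (pair z f) (pair z' f)))

  pair-zero : ∀ z {f} → (∀ v → f v ≡ 0ℤ) → pair z f ≡ 0ℤ
  pair-zero [] f≗0 = refl
  pair-zero ((c , w) ∷ z) f≗0 rewrite f≗0 w | pair-zero z f≗0 = cong (_+ 0ℤ) (ℤP.*-zeroʳ c)

  pair-linear : ∀ z c g h → pair z (λ v → c * g v + h v) ≡ c * pair z g + pair z h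
  pair-linear [] c g h = sym (trans (ℤP.+-identityʳ _) (ℤP.*-zeroʳ c))
  pair-linear ((d , w) ∷ z) c g h rewrite pair-linear z c g h =
    rearrange d c (g w) (h w) (pair z g) (pair z h)
    where
    rearrange : ∀ d c x y p q → d * (c * x + y) + (c * p + q) ≡ c * (d * x + p) + (d * y + q)
    rearrange = solve-∀

  -- The map is the block contributed by the monomial (c , u) in the unfolding of ((c , u) ∷ x) *P z.
  pair-shiftˡ : ∀ c u z f →
    pair (map (λ p → (c * proj₁ p , u ++ proj₂ p)) z) f ≡ c * pair z (λ v → f (u ++ v))
  pair-shiftˡ c u [] f = sym (ℤP.*-zeroʳ c)
  pair-shiftˡ c u ((d , w) ∷ z) f rewrite pair-shiftˡ c u z f = rearrange c d (f (u ++ w)) (pair z (λ v → f (u ++ v)))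
    where
    rearrange : ∀ c d x p → c * d * x + c * p ≡ c * (d * x + p)
    rearrange = solve-∀

  pair-*Pˡ : ∀ x z f → pair (x *P z) f ≡ pair x (λ u → pair z (λ v → f (u ++ v)))
  pair-*Pˡ [] z f = refl
  pair-*Pˡ ((c , u) ∷ x) z f =
    begin
      pair (map (λ p → (c * proj₁ p , u ++ proj₂ p)) z ++ x *P z) f
    ≡⟨ pair-++ (map _ z) (x *P z) f ⟩
      pair (map (λ p → (c * proj₁ p , u ++ proj₂ p)) z) f + pair (x *P z) f
    ≡⟨ cong₂ _+_ (pair-shiftˡ c u z f) (pair-*Pˡ x z f) ⟩
      c * pair z (λ v → f (u ++ v)) + pair x (λ u → pair z (λ v → f (u ++ v)))
    ∎
    where open ≡-Reasoning

  pair-*Pʳ : ∀ z y f → pair (z *P y) f ≡ pair y (λ u → pair z (λ v → f (v ++ u)))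
  pair-*Pʳ [] y f = sym (pair-zero y (λ _ → refl))
  pair-*Pʳ ((c , w) ∷ z) y f =
    begin
      pair (map (λ p → (c * proj₁ p , w ++ proj₂ p)) y ++ z *P y) f
    ≡⟨ pair-++ (map _ y) (z *P y) f ⟩
      pair (map (λ p → (c * proj₁ p , w ++ proj₂ p)) y) f + pair (z *P y) f
    ≡⟨ cong₂ _+_ (pair-shiftˡ c w y f) (pair-*Pʳ z y f) ⟩
      c * pair y (λ u → f (w ++ u)) + pair y (λ u → pair z (λ v → f (v ++ u)))
    ≡⟨ sym (pair-linear y c (λ u → f (w ++ u)) (λ u → pair z (λ v → f (v ++ u)))) ⟩
      pair y (λ u → c * f (w ++ u) + pair z (λ v → f (v ++ u)))
    ∎
    where open ≡-Reasoning

  ∑ : List (Word N) → (Word N → ℤ) → ℤ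
  ∑ L g = foldr (λ v s → g v + s) 0ℤ L

  ∑-cong : ∀ L {g h} → (∀ v → g v ≡ h v) → ∑ L g ≡ ∑ L h
  ∑-cong [] g≗h = refl
  ∑-cong (v ∷ L) g≗h = cong₂ _+_ (g≗h v) (∑-cong L g≗h)

  ∑-+ : ∀ L g h → ∑ L (λ v → g v + h v) ≡ ∑ L g + ∑ L h
  ∑-+ [] g h = refl
  ∑-+ (v ∷ L) g h rewrite ∑-+ L g h = rearrange (g v) (h v) (∑ L g) (∑ L h)
    where
    rearrange : ∀ a b c d → a + b + (c + d) ≡ a + c + (b + d)
    rearrange = solve-∀

  ∑-zero : ∀ L {g} → (∀ v → g v ≡ 0ℤ) → ∑ L g ≡ 0ℤ
  ∑-zero [] g≗0 = refl
  ∑-zero (v ∷ L) g≗0 rewrite g≗0 v = trans (ℤP.+-identityˡ _) (∑-zero L g≗0)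

  zero-summand : ∀ x s → 0ℤ * x + s ≡ s
  zero-summand x s = trans (cong (_+ s) (ℤP.*-zeroˡ x)) (ℤP.+-identityˡ s)

  δ : Word N → ℤ → Word N → ℤ
  δ w c v with w ≟w v
  ... | yes _ = c
  ... | no _ = 0ℤ

  coeff-∷ : ∀ c w z v → coeff ((c , w) ∷ z) v ≡ δ w c v + coeff z v
  coeff-∷ c w z v with w ≟w v
  ... | yes _ = refl
  ... | no _ = sym (ℤP.+-identityˡ _)

  ∑-δ-∉ : ∀ L w c (f : Word N → ℤ) → w ∉ L → ∑ L (λ v → δ w c v * f v) ≡ 0ℤ
  ∑-δ-∉ [] w c f w∉L = refl
  ∑-δ-∉ (v ∷ L) w c f w∉L with w ≟w v
  ... | yes w≡v = ⊥-elim (w∉L (here w≡v))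
  ... | no _ = trans (zero-summand (f v) _) (∑-δ-∉ L w c f (λ w∈L → w∉L (there w∈L)))

  ∑-δ-∈ : ∀ L w c (f : Word N → ℤ) → Unique L → w ∈ L → ∑ L (λ v → δ w c v * f v) ≡ c * f w
  ∑-δ-∈ (v ∷ L) w c f (v∉L ∷ _) w∈vL with w ≟w v
  ∑-δ-∈ (v ∷ L) w c f (v∉L ∷ _) w∈vL | yes refl =
    trans (cong ((c * f w) +_) (∑-δ-∉ L w c f (λ w∈L → All.lookup v∉L w∈L refl))) (ℤP.+-identityʳ (c * f w))
  ∑-δ-∈ (v ∷ L) w c f (_ ∷ _) (here w≡v) | no w≢v = ⊥-elim (w≢v w≡v)
  ∑-δ-∈ (v ∷ L) w c f (_ ∷ uL) (there w∈L) | no _ =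
    trans (zero-summand (f v) _) (∑-δ-∈ L w c f uL w∈L)

  support : Poly N → List (Word N)
  support = map proj₂

  pair≡∑-coeff : ∀ z f L → Unique L → All (_∈ L) (support z) → pair z f ≡ ∑ L (λ v → coeff z v * f v)
  pair≡∑-coeff [] f L uL _ = sym (∑-zero L (λ v → ℤP.*-zeroˡ (f v)))
  pair≡∑-coeff ((c , w) ∷ z) f L uL (w∈L ∷ z⊆L) = sym (begin
      ∑ L (λ v → coeff ((c , w) ∷ z) v * f v)
    ≡⟨ ∑-cong L (λ v → trans (cong (_* f v) (coeff-∷ c w z v)) (ℤP.*-distribʳ-+ (f v) (δ w c v) (coeff z v))) ⟩
      ∑ L (λ v → δ w c v * f v + coeff z v * f v)
    ≡⟨ ∑-+ L (λ v → δ w c v * f v) (λ v → coeff z v * f v) ⟩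
      ∑ L (λ v → δ w c v * f v) + ∑ L (λ v → coeff z v * f v)
    ≡⟨ cong₂ _+_ (∑-δ-∈ L w c f uL w∈L) (sym (pair≡∑-coeff z f L uL z⊆L)) ⟩
      c * f w + pair z f
    ∎)
    where open ≡-Reasoning

  pair-resp-≈P : ∀ {z z'} f → z ≈P z' → pair z f ≡ pair z' f
  pair-resp-≈P {z} {z'} f z≈z' = begin
      pair z f
    ≡⟨ pair≡∑-coeff z f L uL (All.tabulate (λ v∈z → ⊆L (AnyP.++⁺ˡ v∈z))) ⟩
      ∑ L (λ v → coeff z v * f v)
    ≡⟨ ∑-cong L (λ v → cong (_* f v) (z≈z' v)) ⟩
      ∑ L (λ v → coeff z' v * f v)
    ≡⟨ pair≡∑-coeff z' f L uL (All.tabulate (λ v∈z' → ⊆L (AnyP.++⁺ʳ (support z) v∈z'))) ⟨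
      pair z' f
    ∎
    where
    open ≡-Reasoning
    L = deduplicate _≟w_ (support z ++ support z')
    uL : Unique L
    uL = deduplicate-! _≟w_ (support z ++ support z')
    ⊆L : ∀ {v} → v ∈ support z ++ support z' → v ∈ L
    ⊆L = AnyP.deduplicate⁺ _≟w_ (λ v≡u u≡w → trans u≡w (sym v≡u))

  slice : (Word N → Bool) → Word N → Word N → Word N → Bool
  slice W x y t = W (x ++ t ++ y)

  AnnihilatesGenerators : (Word N → Bool) → Set
  AnnihilatesGenerators S = ∀ {r} → SGen r → pairSum r S ≡ 0ℤ

  SlicesAnnihilateGenerators : (Word N → Bool) → Set
  SlicesAnnihilateGenerators W = ∀ x y → AnnihilatesGenerators (slice W x y)

  pairSum-cong : ∀ z {S S' : Word N → Bool} → (∀ v → S v ≡ S' v) → pairSum z S ≡ pairSum z S'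
  pairSum-cong [] S≗S' = refl
  pairSum-cong ((c , w) ∷ z) S≗S' rewrite S≗S' w | pairSum-cong z S≗S' = refl

  perp⇒slicesAnnihilate : ∀ W → SumInISPerp W → SlicesAnnihilateGenerators W
  perp⇒slicesAnnihilate W W⊥ x y {r} r∈S = begin
      pairSum r (slice W x y)
    ≡⟨ pairSum-cong r (λ t → cong W (sym (ListP.++-assoc x t y))) ⟩
      pairSum r (λ t → W ((x ++ t) ++ y))
    ≡⟨ pairSum≡pair-indicator r _ ⟩
      pair r (λ t → f ((x ++ t) ++ y))
    ≡⟨ pair-singleton x (λ u → pair r (λ t → f ((u ++ t) ++ y))) ⟨
      pair X (λ u → pair r (λ t → f ((u ++ t) ++ y)))
    ≡⟨ pair-*Pˡ X r (λ v → f (v ++ y)) ⟨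
      pair (X *P r) (λ v → f (v ++ y))
    ≡⟨ pair-singleton y (λ u → pair (X *P r) (λ v → f (v ++ u))) ⟨
      pair Y (λ u → pair (X *P r) (λ v → f (v ++ u)))
    ≡⟨ pair-*Pʳ (X *P r) Y f ⟨
      pair ((X *P r) *P Y) f
    ≡⟨ pairSum≡pair-indicator ((X *P r) *P Y) W ⟨
      pairSum ((X *P r) *P Y) W
    ≡⟨ W⊥ _ (mulʳ Y (mulˡ X (gen r∈S))) ⟩
      0ℤ
    ∎
    where
    open ≡-Reasoning
    f = indicator W
    X Y : Poly N
    X = (1ℤ , x) ∷ []
    Y = (1ℤ , y) ∷ []

  slicesAnnihilate-prefix : ∀ W u → SlicesAnnihilateGenerators W → SlicesAnnihilateGenerators (λ v → W (u ++ v))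
  slicesAnnihilate-prefix W u W-ann x y {r} r∈S =
    trans (pairSum-cong r (λ t → cong W (sym (ListP.++-assoc u x (t ++ y))))) (W-ann (u ++ x) y r∈S)

  slicesAnnihilate-suffix : ∀ W u → SlicesAnnihilateGenerators W → SlicesAnnihilateGenerators (λ v → W (v ++ u))
  slicesAnnihilate-suffix W u W-ann x y {r} r∈S =
    trans (pairSum-cong r (λ t → cong W (trans (ListP.++-assoc x (t ++ y) u) (cong (x ++_) (ListP.++-assoc t y u)))))
          (W-ann x (y ++ u) r∈S)

  slicesAnnihilate⇒pair≡0 : ∀ {z} → InIS z → ∀ W → SlicesAnnihilateGenerators W → pair z (indicator W) ≡ 0ℤ
  slicesAnnihilate⇒pair≡0 (gen {r} r∈S) W W-ann =
    trans (sym (pairSum≡pair-indicator r W))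
          (trans (pairSum-cong r (λ t → cong W (sym (ListP.++-identityʳ t)))) (W-ann [] [] r∈S))
  slicesAnnihilate⇒pair≡0 zero W W-ann = refl
  slicesAnnihilate⇒pair≡0 (add {z} {z'} z∈I z'∈I) W W-ann =
    trans (pair-++ z z' (indicator W))
          (cong₂ _+_ (slicesAnnihilate⇒pair≡0 z∈I W W-ann) (slicesAnnihilate⇒pair≡0 z'∈I W W-ann))
  slicesAnnihilate⇒pair≡0 (mulˡ {z} x z∈I) W W-ann =
    trans (pair-*Pˡ x z (indicator W))
          (pair-zero x (λ u → slicesAnnihilate⇒pair≡0 z∈I _ (slicesAnnihilate-prefix W u W-ann)))
  slicesAnnihilate⇒pair≡0 (mulʳ {z} y z∈I) W W-ann =
    trans (pair-*Pʳ z y (indicator W))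
          (pair-zero y (λ u → slicesAnnihilate⇒pair≡0 z∈I _ (slicesAnnihilate-suffix W u W-ann)))
  slicesAnnihilate⇒pair≡0 (resp {z} {z'} z≈z' z∈I) W W-ann =
    trans (sym (pair-resp-≈P {z} {z'} (indicator W) z≈z')) (slicesAnnihilate⇒pair≡0 z∈I W W-ann)

  slicesAnnihilate⇒perp : ∀ W → SlicesAnnihilateGenerators W → SumInISPerp W
  slicesAnnihilate⇒perp W W-ann z z∈I = trans (pairSum≡pair-indicator z W) (slicesAnnihilate⇒pair≡0 z∈I W W-ann)

-- Switches of triples

module _ {N : ℕ} where

  _<ᵇ_ _≡ᵇ_ : Letter N → Letter N → Bool
  a <ᵇ b = does (a <? b)
  a ≡ᵇ b = does (a ≟ b)

  adjacentᵇ : Letter N → Letter N → Bool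
  adjacentᵇ a b = does (toℕ b ℕ.≟ suc (toℕ a)) ∨ does (toℕ a ℕ.≟ suc (toℕ b))

  -- bac ↔ bca and bab ↔ bba exchange the last two letters, acb ↔ cab and aba ↔ baa the first two.
  knuthPartner : Word N → Word N
  knuthPartner (p ∷ q ∷ r ∷ []) = if (q <ᵇ p) xor (r <ᵇ p) then p ∷ r ∷ q ∷ [] else q ∷ p ∷ r ∷ []
  knuthPartner t = t

  -- The partner under a rotation, braid or idempotent switch; a triple bab, bba, aba or baa
  -- with b - a ≥ 2 has no such partner and is its own.
  otherPartner : Word N → Word N
  otherPartner (p ∷ q ∷ r ∷ []) =
    if p ≡ᵇ r then (if adjacentᵇ p q then q ∷ p ∷ q ∷ [] else p ∷ q ∷ r ∷ [])
    else if p ≡ᵇ q then (if adjacentᵇ p r then p ∷ r ∷ r ∷ [] else p ∷ q ∷ r ∷ [])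
    else if q ≡ᵇ r then (if adjacentᵇ p q then p ∷ p ∷ q ∷ [] else p ∷ q ∷ r ∷ [])
    else (if (q <ᵇ p) xor (r <ᵇ p) then q ∷ r ∷ p ∷ [] else r ∷ p ∷ q ∷ [])
  otherPartner t = t

  <ᵇ-true : ∀ {a b} → a < b → (a <ᵇ b) ≡ true
  <ᵇ-true {a} {b} = dec-true (a <? b)

  <ᵇ-false : ∀ {a b} → b < a → (a <ᵇ b) ≡ false
  <ᵇ-false {a} {b} b<a = dec-false (a <? b) (FinP.<-asym b<a)

  <ᵇ-irrefl : ∀ a → (a <ᵇ a) ≡ false
  <ᵇ-irrefl a = dec-false (a <? a) (FinP.<-irrefl refl)

  ≡ᵇ-refl : ∀ a → (a ≡ᵇ a) ≡ true
  ≡ᵇ-refl a = dec-true (a ≟ a) refl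

  ≡ᵇ-false-< : ∀ {a b} → a < b → (a ≡ᵇ b) ≡ false
  ≡ᵇ-false-< {a} {b} a<b = dec-false (a ≟ b) (FinP.<⇒≢ a<b)

  ≡ᵇ-false-> : ∀ {a b} → b < a → (a ≡ᵇ b) ≡ false
  ≡ᵇ-false-> {a} {b} b<a = dec-false (a ≟ b) (≢-sym (FinP.<⇒≢ b<a))

  Adjacent Distant : Letter N → Letter N → Set
  Adjacent a b = toℕ b ≡ suc (toℕ a)
  Distant a b = 2 ℕ.+ toℕ a ≤ toℕ b

  adjacent-or-distant : ∀ {a b} → a < b → Adjacent a b ⊎ Distant a b
  adjacent-or-distant a<b = Sum.map sym id (Sum.swap (ℕP.m≤n⇒m<n∨m≡n a<b))

  adjacentᵇ-true : ∀ {a b} → Adjacent a b → adjacentᵇ a b ≡ true × adjacentᵇ b a ≡ true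
  adjacentᵇ-true {a} {b} b≡1+a
    rewrite dec-true (toℕ b ℕ.≟ suc (toℕ a)) b≡1+a
          | dec-false (toℕ a ℕ.≟ suc (toℕ b)) (λ a≡1+b → ℕP.<-asym (ℕP.≤-reflexive (sym b≡1+a)) (ℕP.≤-reflexive (sym a≡1+b)))
    = refl , refl

  adjacentᵇ-false : ∀ {a b} → Distant a b → adjacentᵇ a b ≡ false × adjacentᵇ b a ≡ false
  adjacentᵇ-false {a} {b} 2+a≤b
    rewrite dec-false (toℕ b ℕ.≟ suc (toℕ a)) (λ b≡1+a → ℕP.<-irrefl (sym b≡1+a) 2+a≤b)
          | dec-false (toℕ a ℕ.≟ suc (toℕ b)) (λ a≡1+b → ℕP.<-asym (ℕP.<-trans (ℕP.n<1+n _) 2+a≤b) (ℕP.≤-reflexive (sym a≡1+b)))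
    = refl , refl

  module DistinctLetters {a b c : Letter N} (a<b : a < b) (b<c : b < c) where
    a<c : a < c
    a<c = FinP.<-trans a<b b<c

    knuth-bac : knuthPartner (b ∷ a ∷ c ∷ []) ≡ b ∷ c ∷ a ∷ []
    knuth-bac rewrite <ᵇ-true a<b | <ᵇ-false b<c = refl
    knuth-bca : knuthPartner (b ∷ c ∷ a ∷ []) ≡ b ∷ a ∷ c ∷ []
    knuth-bca rewrite <ᵇ-true a<b | <ᵇ-false b<c = refl
    knuth-acb : knuthPartner (a ∷ c ∷ b ∷ []) ≡ c ∷ a ∷ b ∷ []
    knuth-acb rewrite <ᵇ-false a<c | <ᵇ-false a<b = refl
    knuth-cab : knuthPartner (c ∷ a ∷ b ∷ []) ≡ a ∷ c ∷ b ∷ []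
    knuth-cab rewrite <ᵇ-true a<c | <ᵇ-true b<c = refl

    other-bac : otherPartner (b ∷ a ∷ c ∷ []) ≡ a ∷ c ∷ b ∷ []
    other-bac rewrite ≡ᵇ-false-< b<c | ≡ᵇ-false-> a<b | ≡ᵇ-false-< a<c | <ᵇ-true a<b | <ᵇ-false b<c = refl
    other-bca : otherPartner (b ∷ c ∷ a ∷ []) ≡ c ∷ a ∷ b ∷ []
    other-bca rewrite ≡ᵇ-false-> a<b | ≡ᵇ-false-< b<c | ≡ᵇ-false-> a<c | <ᵇ-true a<b | <ᵇ-false b<c = refl
    other-acb : otherPartner (a ∷ c ∷ b ∷ []) ≡ b ∷ a ∷ c ∷ []
    other-acb rewrite ≡ᵇ-false-< a<b | ≡ᵇ-false-< a<c | ≡ᵇ-false-> b<c | <ᵇ-false a<c | <ᵇ-false a<b = refl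
    other-cab : otherPartner (c ∷ a ∷ b ∷ []) ≡ b ∷ c ∷ a ∷ []
    other-cab rewrite ≡ᵇ-false-> b<c | ≡ᵇ-false-> a<c | ≡ᵇ-false-< a<b | <ᵇ-true a<c | <ᵇ-true b<c = refl

  module RepeatedLetter {a b : Letter N} (a<b : a < b) where
    knuth-bab : knuthPartner (b ∷ a ∷ b ∷ []) ≡ b ∷ b ∷ a ∷ []
    knuth-bab rewrite <ᵇ-true a<b | <ᵇ-irrefl b = refl
    knuth-bba : knuthPartner (b ∷ b ∷ a ∷ []) ≡ b ∷ a ∷ b ∷ []
    knuth-bba rewrite <ᵇ-true a<b | <ᵇ-irrefl b = refl
    knuth-aba : knuthPartner (a ∷ b ∷ a ∷ []) ≡ b ∷ a ∷ a ∷ []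
    knuth-aba rewrite <ᵇ-false a<b | <ᵇ-irrefl a = refl
    knuth-baa : knuthPartner (b ∷ a ∷ a ∷ []) ≡ a ∷ b ∷ a ∷ []
    knuth-baa rewrite <ᵇ-true a<b = refl

  adjacent⇒< : ∀ {a b} → Adjacent a b → a < b
  adjacent⇒< b≡1+a = ℕP.≤-reflexive (sym b≡1+a)

  distant⇒< : ∀ {a b} → Distant a b → a < b
  distant⇒< 2+a≤b = ℕP.<-trans (ℕP.n<1+n _) 2+a≤b

  module AdjacentLetters {a b : Letter N} (b≡1+a : Adjacent a b) where
    private
      a<b : a < b
      a<b = adjacent⇒< b≡1+a

    other-bab : otherPartner (b ∷ a ∷ b ∷ []) ≡ a ∷ b ∷ a ∷ []
    other-bab rewrite ≡ᵇ-refl b | proj₂ (adjacentᵇ-true b≡1+a) = refl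
    other-aba : otherPartner (a ∷ b ∷ a ∷ []) ≡ b ∷ a ∷ b ∷ []
    other-aba rewrite ≡ᵇ-refl a | proj₁ (adjacentᵇ-true b≡1+a) = refl
    other-bba : otherPartner (b ∷ b ∷ a ∷ []) ≡ b ∷ a ∷ a ∷ []
    other-bba rewrite ≡ᵇ-false-> a<b | ≡ᵇ-refl b | proj₂ (adjacentᵇ-true b≡1+a) = refl
    other-baa : otherPartner (b ∷ a ∷ a ∷ []) ≡ b ∷ b ∷ a ∷ []
    other-baa rewrite ≡ᵇ-false-> a<b | ≡ᵇ-refl a | proj₂ (adjacentᵇ-true b≡1+a) = refl

  module DistantLetters {a b : Letter N} (2+a≤b : Distant a b) where
    private
      a<b : a < b
      a<b = distant⇒< 2+a≤b

    other-bab : otherPartner (b ∷ a ∷ b ∷ []) ≡ b ∷ a ∷ b ∷ []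
    other-bab rewrite ≡ᵇ-refl b | proj₂ (adjacentᵇ-false 2+a≤b) = refl
    other-aba : otherPartner (a ∷ b ∷ a ∷ []) ≡ a ∷ b ∷ a ∷ []
    other-aba rewrite ≡ᵇ-refl a | proj₁ (adjacentᵇ-false 2+a≤b) = refl
    other-bba : otherPartner (b ∷ b ∷ a ∷ []) ≡ b ∷ b ∷ a ∷ []
    other-bba rewrite ≡ᵇ-false-> a<b | ≡ᵇ-refl b | proj₂ (adjacentᵇ-false 2+a≤b) = refl
    other-baa : otherPartner (b ∷ a ∷ a ∷ []) ≡ b ∷ a ∷ a ∷ []
    other-baa rewrite ≡ᵇ-false-> a<b | ≡ᵇ-refl a | proj₂ (adjacentᵇ-false 2+a≤b) = refl

  MutualPartners : (Word N → Word N) → Word N → Word N → Set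
  MutualPartners f t t' = t' ≡ f t × t ≡ f t'

  switchPair-partners : ∀ {t t' : Word N} → SwitchPair t t' → MutualPartners knuthPartner t t' ⊎ MutualPartners otherPartner t t'
  switchPair-partners (knuth₁ a b c a<b b<c) = inj₁ (sym knuth-bac , sym knuth-bca) where open DistinctLetters a<b b<c
  switchPair-partners (knuth₂ a b c a<b b<c) = inj₁ (sym knuth-acb , sym knuth-cab) where open DistinctLetters a<b b<c
  switchPair-partners (rot₁ a b c a<b b<c)   = inj₂ (sym other-bac , sym other-acb) where open DistinctLetters a<b b<c
  switchPair-partners (rot₂ a b c a<b b<c)   = inj₂ (sym other-bca , sym other-cab) where open DistinctLetters a<b b<c
  switchPair-partners (knuth₃ a b a<b)       = inj₁ (sym knuth-bab , sym knuth-bba) where open RepeatedLetter a<b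
  switchPair-partners (knuth₄ a b a<b)       = inj₁ (sym knuth-aba , sym knuth-baa) where open RepeatedLetter a<b
  switchPair-partners (braid a b b≡1+a)      = inj₂ (sym other-bab , sym other-aba) where open AdjacentLetters b≡1+a
  switchPair-partners (idem a b b≡1+a)       = inj₂ (sym other-bba , sym other-baa) where open AdjacentLetters b≡1+a

  switch-partners : ∀ {t t' : Word N} → SwitchTriple t t' → MutualPartners knuthPartner t t' ⊎ MutualPartners otherPartner t t'
  switch-partners (inj₁ s) = switchPair-partners s
  switch-partners (inj₂ s) = Sum.map Product.swap Product.swap (switchPair-partners s)

  switchPair-irrefl : ∀ {t : Word N} → ¬ SwitchPair t t
  switchPair-irrefl (knuth₁ a b c a<b b<a) = FinP.<-asym a<b b<a
  switchPair-irrefl (knuth₂ a b c a<b b<a) = FinP.<-asym a<b b<a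
  switchPair-irrefl (rot₁ a b c a<b b<a)   = FinP.<-asym a<b b<a
  switchPair-irrefl (rot₂ a b c a<b b<a)   = FinP.<-asym a<b b<a
  switchPair-irrefl (knuth₃ a b a<a)       = FinP.<-irrefl refl a<a
  switchPair-irrefl (knuth₄ a b a<a)       = FinP.<-irrefl refl a<a
  switchPair-irrefl (braid a b a≡1+a)      = ℕP.1+n≢n (sym a≡1+a)
  switchPair-irrefl (idem a b a≡1+a)       = ℕP.1+n≢n (sym a≡1+a)

  switch-irrefl : ∀ {t : Word N} → ¬ SwitchTriple t t
  switch-irrefl (inj₁ s) = switchPair-irrefl s
  switch-irrefl (inj₂ s) = switchPair-irrefl s

  switchPair-length : ∀ {t t' : Word N} → SwitchPair t t' → length t ≡ 3 × length t' ≡ 3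
  switchPair-length (knuth₁ _ _ _ _ _) = refl , refl
  switchPair-length (knuth₂ _ _ _ _ _) = refl , refl
  switchPair-length (rot₁ _ _ _ _ _)   = refl , refl
  switchPair-length (rot₂ _ _ _ _ _)   = refl , refl
  switchPair-length (knuth₃ _ _ _)     = refl , refl
  switchPair-length (knuth₄ _ _ _)     = refl , refl
  switchPair-length (braid _ _ _)      = refl , refl
  switchPair-length (idem _ _ _)       = refl , refl

  switch-length : ∀ {t t' : Word N} → SwitchTriple t t' → length t ≡ 3 × length t' ≡ 3
  switch-length (inj₁ s) = switchPair-length s
  switch-length (inj₂ s) = let l , l' = switchPair-length s in l' , l

  OneDescent : Letter N → Letter N → Letter N → Set
  OneDescent p q r = (q < p × ¬ r < q) ⊎ (¬ q < p × r < q)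

  data Shape : Word N → Set where
    bac : ∀ {a b c} → a < b → b < c → Shape (b ∷ a ∷ c ∷ [])
    bca : ∀ {a b c} → a < b → b < c → Shape (b ∷ c ∷ a ∷ [])
    acb : ∀ {a b c} → a < b → b < c → Shape (a ∷ c ∷ b ∷ [])
    cab : ∀ {a b c} → a < b → b < c → Shape (c ∷ a ∷ b ∷ [])
    bab : ∀ {a b} → a < b → Shape (b ∷ a ∷ b ∷ [])
    bba : ∀ {a b} → a < b → Shape (b ∷ b ∷ a ∷ [])
    aba : ∀ {a b} → a < b → Shape (a ∷ b ∷ a ∷ [])
    baa : ∀ {a b} → a < b → Shape (b ∷ a ∷ a ∷ [])

  shape : ∀ {p q r} → OneDescent p q r → Shape (p ∷ q ∷ r ∷ [])
  shape {p} {q} {r} (inj₁ (q<p , r≮q)) with FinP.<-cmp r p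
  ... | tri≈ _ refl _ = bab q<p
  ... | tri> _ _ p<r = bac q<p p<r
  ... | tri< r<p _ _ with FinP.<-cmp q r
  ...   | tri< q<r _ _ = cab q<r r<p
  ...   | tri≈ _ refl _ = baa q<p
  ...   | tri> _ _ r<q = ⊥-elim (r≮q r<q)
  shape {p} {q} {r} (inj₂ (q≮p , r<q)) with FinP.<-cmp r p
  ... | tri≈ _ refl _ = aba r<q
  ... | tri> _ _ p<r = acb p<r r<q
  ... | tri< r<p _ _ with FinP.<-cmp p q
  ...   | tri< p<q _ _ = bca r<p p<q
  ...   | tri≈ _ refl _ = bba r<p
  ...   | tri> _ _ q<p = ⊥-elim (q≮p q<p)

  χ : Bool → ℤ
  χ b = if b then 1ℤ else 0ℤ

  annihilated-pair : ∀ (S : Word N → Bool) {t₁ t₂} → pairSum (pos t₁ ∷ neg t₂ ∷ []) S ≡ 0ℤ → S t₂ ≡ S t₁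
  annihilated-pair S {t₁} {t₂} = cases (S t₁) (S t₂)
    where
    cases : ∀ b₁ b₂ → 1ℤ * χ b₁ + (-1ℤ * χ b₂ + 0ℤ) ≡ 0ℤ → b₂ ≡ b₁
    cases true  true  _ = refl
    cases false false _ = refl
    cases true  false ()
    cases false true  ()

  annihilated-quad : ∀ (S : Word N → Bool) {t₁ t₂ t₃ t₄} →
    pairSum (pos t₁ ∷ pos t₂ ∷ neg t₃ ∷ neg t₄ ∷ []) S ≡ 0ℤ → χ (S t₃) + χ (S t₄) ≡ χ (S t₁) + χ (S t₂)
  annihilated-quad S {t₁} {t₂} {t₃} {t₄} = cases (S t₁) (S t₂) (S t₃) (S t₄)
    where
    cases : ∀ b₁ b₂ b₃ b₄ → 1ℤ * χ b₁ + (1ℤ * χ b₂ + (-1ℤ * χ b₃ + (-1ℤ * χ b₄ + 0ℤ))) ≡ 0ℤ →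
            χ b₃ + χ b₄ ≡ χ b₁ + χ b₂
    cases true  true  true  true  _ = refl
    cases true  false true  false _ = refl
    cases true  false false true  _ = refl
    cases false true  true  false _ = refl
    cases false true  false true  _ = refl
    cases false false false false _ = refl
    cases true  true  true  false ()
    cases true  true  false true  ()
    cases true  true  false false ()
    cases true  false true  true  ()
    cases true  false false false ()
    cases false true  true  true  ()
    cases false true  false false ()
    cases false false true  true  ()
    cases false false true  false ()
    cases false false false true  ()

  annihilated-quad′ : ∀ (S : Word N → Bool) {t₁ t₂ t₃ t₄} →
    pairSum (pos t₁ ∷ pos t₂ ∷ neg t₃ ∷ neg t₄ ∷ []) S ≡ 0ℤ → χ (S t₄) + χ (S t₃) ≡ χ (S t₂) + χ (S t₁)
  annihilated-quad′ S {t₁} {t₂} {t₃} {t₄} ann =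
    trans (ℤP.+-comm (χ (S t₄)) _) (trans (annihilated-quad S ann) (ℤP.+-comm (χ (S t₁)) _))

  -- The square t, knuthPartner t, knuthPartner (otherPartner t), otherPartner t is a 4-cycle of
  -- switches on which a generator is the alternating sum; annihilating it balances opposite corners.
  Balanced : (Word N → Bool) → Word N → Set
  Balanced S t = χ (S t) + χ (S (knuthPartner (otherPartner t))) ≡ χ (S (knuthPartner t)) + χ (S (otherPartner t))

  record Neighbourhood (t : Word N) : Set₁ where
    field
      knuth-switch     : SwitchTriple t (knuthPartner t)
      knuth-involutive : knuthPartner (knuthPartner t) ≡ t
      knuth-forced-or-square :
        (∀ S → AnnihilatesGenerators S → S (knuthPartner t) ≡ S t) ⊎
        (SwitchTriple t (otherPartner t) × (∀ S → AnnihilatesGenerators S → Balanced S t))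

  knuthForced : ∀ {t k} → knuthPartner t ≡ k → knuthPartner k ≡ t → SwitchTriple t k →
                (∀ S → AnnihilatesGenerators S → S k ≡ S t) → Neighbourhood t
  knuthForced refl k²≡t t⇄k forced = record
    { knuth-switch = t⇄k ; knuth-involutive = k²≡t ; knuth-forced-or-square = inj₁ forced }

  square : ∀ {t k o t̄} → knuthPartner t ≡ k → knuthPartner k ≡ t → otherPartner t ≡ o → knuthPartner o ≡ t̄ →
           SwitchTriple t k → SwitchTriple t o →
           (∀ S → AnnihilatesGenerators S → χ (S t) + χ (S t̄) ≡ χ (S k) + χ (S o)) → Neighbourhood t
  square refl k²≡t refl refl t⇄k t⇄o balanced = record
    { knuth-switch = t⇄k ; knuth-involutive = k²≡t ; knuth-forced-or-square = inj₂ (t⇄o , balanced) }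

  neighbourhood : ∀ {t} → Shape t → Neighbourhood t
  neighbourhood (bac {a} {b} {c} a<b b<c) =
    square knuth-bac knuth-bca other-bac knuth-acb (inj₁ (knuth₁ a b c a<b b<c)) (inj₁ (rot₁ a b c a<b b<c))
      (λ S ann → annihilated-quad S (ann (gen-three a b c a<b b<c)))
    where open DistinctLetters a<b b<c
  neighbourhood (bca {a} {b} {c} a<b b<c) =
    square knuth-bca knuth-bac other-bca knuth-cab (inj₂ (knuth₁ a b c a<b b<c)) (inj₁ (rot₂ a b c a<b b<c))
      (λ S ann → sym (annihilated-quad S (ann (gen-three a b c a<b b<c))))
    where open DistinctLetters a<b b<c
  neighbourhood (acb {a} {b} {c} a<b b<c) =
    square knuth-acb knuth-cab other-acb knuth-bac (inj₁ (knuth₂ a b c a<b b<c)) (inj₂ (rot₁ a b c a<b b<c))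
      (λ S ann → sym (annihilated-quad′ S (ann (gen-three a b c a<b b<c))))
    where open DistinctLetters a<b b<c
  neighbourhood (cab {a} {b} {c} a<b b<c) =
    square knuth-cab knuth-acb other-cab knuth-bca (inj₂ (knuth₂ a b c a<b b<c)) (inj₂ (rot₂ a b c a<b b<c))
      (λ S ann → annihilated-quad′ S (ann (gen-three a b c a<b b<c)))
    where open DistinctLetters a<b b<c
  neighbourhood (bab {a} {b} a<b) with adjacent-or-distant a<b
  ... | inj₁ adj = square knuth-bab knuth-bba other-bab knuth-aba (inj₁ (knuth₃ a b a<b)) (inj₁ (braid a b adj))
                     (λ S ann → annihilated-quad S (ann (gen-adj a b adj)))
    where open RepeatedLetter a<b
          open AdjacentLetters adj
  ... | inj₂ far = knuthForced knuth-bab knuth-bba (inj₁ (knuth₃ a b a<b)) (λ S ann → sym (annihilated-pair S (ann (gen-far₁ a b far))))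
    where open RepeatedLetter a<b
  neighbourhood (bba {a} {b} a<b) with adjacent-or-distant a<b
  ... | inj₁ adj = square knuth-bba knuth-bab other-bba knuth-baa (inj₂ (knuth₃ a b a<b)) (inj₁ (idem a b adj))
                     (λ S ann → sym (annihilated-quad S (ann (gen-adj a b adj))))
    where open RepeatedLetter a<b
          open AdjacentLetters adj
  ... | inj₂ far = knuthForced knuth-bba knuth-bab (inj₂ (knuth₃ a b a<b)) (λ S ann → annihilated-pair S (ann (gen-far₁ a b far)))
    where open RepeatedLetter a<b
  neighbourhood (aba {a} {b} a<b) with adjacent-or-distant a<b
  ... | inj₁ adj = square knuth-aba knuth-baa other-aba knuth-bab (inj₁ (knuth₄ a b a<b)) (inj₂ (braid a b adj))
                     (λ S ann → sym (annihilated-quad′ S (ann (gen-adj a b adj))))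
    where open RepeatedLetter a<b
          open AdjacentLetters adj
  ... | inj₂ far = knuthForced knuth-aba knuth-baa (inj₁ (knuth₄ a b a<b)) (λ S ann → sym (annihilated-pair S (ann (gen-far₂ a b far))))
    where open RepeatedLetter a<b
  neighbourhood (baa {a} {b} a<b) with adjacent-or-distant a<b
  ... | inj₁ adj = square knuth-baa knuth-aba other-baa knuth-bba (inj₂ (knuth₄ a b a<b)) (inj₂ (idem a b adj))
                     (λ S ann → annihilated-quad′ S (ann (gen-adj a b adj)))
    where open RepeatedLetter a<b
          open AdjacentLetters adj
  ... | inj₂ far = knuthForced knuth-baa knuth-aba (inj₂ (knuth₄ a b a<b)) (λ S ann → annihilated-pair S (ann (gen-far₂ a b far)))
    where open RepeatedLetter a<b

  -- Knuth switches are preferred: a triple is joined along its other switch only when neither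
  -- endpoint has its Knuth partner in S.
  LocalEdge : (Word N → Bool) → Word N → Word N → Set
  LocalEdge S t t' = S t ≡ true × S t' ≡ true × SwitchTriple t t' ×
                     (MutualPartners knuthPartner t t' ⊎ (S (knuthPartner t) ≡ false × S (knuthPartner t') ≡ false))

  localEdge-sym : ∀ {S t t'} → LocalEdge S t t' → LocalEdge S t' t
  localEdge-sym (St , St' , t⇄t' , kind) =
    St' , St , Sum.swap t⇄t' , Sum.map Product.swap Product.swap kind

  -- The switchboard condition for words of length 3.
  record LocalSwitchboard (S : Word N → Bool) (M : Word N → Word N → Set) : Set where
    field
      switch         : ∀ {t t'} → M t t' → SwitchTriple t t'
      member         : ∀ {t t'} → M t t' → S t' ≡ true
      symmetric      : ∀ {t t'} → M t t' → M t' t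
      unique-partner : ∀ {p q r} → OneDescent p q r → S (p ∷ q ∷ r ∷ []) ≡ true → ∃! _≡_ (M (p ∷ q ∷ r ∷ []))

  opposite-corner : ∀ {x y z w} → x ≡ true → y ≡ false → χ x + χ z ≡ χ y + χ w → z ≡ false × w ≡ true
  opposite-corner {z = false} {w = true} refl refl _ = refl , refl
  opposite-corner {z = false} {w = false} refl refl ()
  opposite-corner {z = true} {w = true} refl refl ()
  opposite-corner {z = true} {w = false} refl refl ()

  module _ {S : Word N → Bool} {t : Word N} (St : S t ≡ true) (nb : Neighbourhood t) where
    open Neighbourhood nb

    unique-localEdge-knuth : S (knuthPartner t) ≡ true → ∃! _≡_ (LocalEdge S t)
    unique-localEdge-knuth Sk = knuthPartner t , (St , Sk , knuth-switch , inj₁ (refl , sym knuth-involutive)) , knuth-only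
      where
      knuth-only : ∀ {t'} → LocalEdge S t t' → knuthPartner t ≡ t'
      knuth-only (_ , _ , _ , inj₁ (t'≡k , _)) = sym t'≡k
      knuth-only (_ , _ , _ , inj₂ (Sk≡false , _)) = contradiction (trans (sym Sk) Sk≡false) λ ()

    unique-localEdge-other : AnnihilatesGenerators S → S (knuthPartner t) ≡ false → ∃! _≡_ (LocalEdge S t)
    unique-localEdge-other ann Sk with knuth-forced-or-square
    ... | inj₁ forced = contradiction (trans (sym St) (trans (sym (forced S ann)) Sk)) λ ()
    ... | inj₂ (t⇄o , balanced) = otherPartner t , (St , So , t⇄o , inj₂ (Sk , Sko)) , other-only
      where
      Sko = proj₁ (opposite-corner St Sk (balanced S ann))
      So = proj₂ (opposite-corner St Sk (balanced S ann))
      other-only : ∀ {t'} → LocalEdge S t t' → otherPartner t ≡ t'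
      other-only (_ , St' , t⇄t' , _) with switch-partners t⇄t'
      ... | inj₁ (t'≡k , _) = contradiction (trans (sym St') (trans (cong S t'≡k) Sk)) λ ()
      ... | inj₂ (t'≡o , _) = sym t'≡o

    unique-localEdge : AnnihilatesGenerators S → ∃! _≡_ (LocalEdge S t)
    unique-localEdge ann = by-cases (S (knuthPartner t)) refl
      where
      by-cases : ∀ b → S (knuthPartner t) ≡ b → ∃! _≡_ (LocalEdge S t)
      by-cases true  = unique-localEdge-knuth
      by-cases false = unique-localEdge-other ann

  annihilates⇒localSwitchboard : ∀ {S} → AnnihilatesGenerators S → LocalSwitchboard S (LocalEdge S)
  annihilates⇒localSwitchboard ann = record
    { switch         = λ (_ , _ , t⇄t' , _) → t⇄t'
    ; member         = λ (_ , St' , _) → St'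
    ; symmetric      = localEdge-sym
    ; unique-partner = λ one St → unique-localEdge St (neighbourhood (shape one)) ann
    }

  SwitchPartnersAmong : Word N → Word N → Word N → Set
  SwitchPartnersAmong t u₁ u₂ = ∀ {t'} → SwitchTriple t t' → t' ≡ u₁ ⊎ t' ≡ u₂

  switchPartnersAmong : ∀ {t u₁ u₂} → knuthPartner t ≡ u₁ → otherPartner t ≡ u₂ → SwitchPartnersAmong t u₁ u₂
  switchPartnersAmong k≡u₁ o≡u₂ t⇄t' with switch-partners t⇄t'
  ... | inj₁ (t'≡k , _) = inj₁ (trans t'≡k k≡u₁)
  ... | inj₂ (t'≡o , _) = inj₂ (trans t'≡o o≡u₂)

  switchPartnersAmong-swap : ∀ {t u₁ u₂} → SwitchPartnersAmong t u₁ u₂ → SwitchPartnersAmong t u₂ u₁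
  switchPartnersAmong-swap among t⇄t' = Sum.swap (among t⇄t')

  ∷-≢ˡ : ∀ {x y : Letter N} {xs ys : Word N} → x ≢ y → x ∷ xs ≢ y ∷ ys
  ∷-≢ˡ x≢y refl = x≢y refl

  ∷-≢ʳ : ∀ {x y : Letter N} {xs ys : Word N} → xs ≢ ys → x ∷ xs ≢ y ∷ ys
  ∷-≢ʳ xs≢ys refl = xs≢ys refl

  module _ {S : Word N → Bool} {M : Word N → Word N → Set} (ls : LocalSwitchboard S M) where
    open LocalSwitchboard ls

    HasUniquePartner : Word N → Set
    HasUniquePartner t = S t ≡ true → ∃! _≡_ (M t)

    Matched : Word N → Word N → Word N → Set
    Matched t u₁ u₂ = HasUniquePartner t × SwitchPartnersAmong t u₁ u₂

    present-partner : ∀ {t u₁ u₂} → Matched t u₁ u₂ → S t ≡ true → (M t u₁ × S u₁ ≡ true) ⊎ (M t u₂ × S u₂ ≡ true)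
    present-partner (unique , among) St with unique St
    ... | t' , t~t' , _ with among (switch t~t')
    ...   | inj₁ refl = inj₁ (t~t' , member t~t')
    ...   | inj₂ refl = inj₂ (t~t' , member t~t')

    shared-partner : ∀ {t t' u} → HasUniquePartner u → S u ≡ true → M t u → M t' u → t ≡ t'
    shared-partner unique Su t~u t'~u with unique Su
    ... | _ , _ , only = trans (sym (only (symmetric t~u))) (only (symmetric t'~u))

    true≢false : ∀ {b} → b ≡ true → b ≡ false → ⊥
    true≢false refl ()

    stranded : ∀ {t u₁ u₂} → Matched t u₁ u₂ → S t ≡ true → S u₁ ≡ false → S u₂ ≡ false → ⊥
    stranded m St Su₁ Su₂ with present-partner m St
    ... | inj₁ (_ , Su₁′) = true≢false Su₁′ Su₁
    ... | inj₂ (_ , Su₂′) = true≢false Su₂′ Su₂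

    crowded : ∀ {t t' u₁ u₂} → t ≢ t' → Matched t u₁ u₂ → Matched t' u₁ u₂ → HasUniquePartner u₁ → HasUniquePartner u₂ →
              S t ≡ true → S t' ≡ true → S u₁ ≡ false ⊎ S u₂ ≡ false → ⊥
    crowded t≢t' m m' unique₁ unique₂ St St' absent with present-partner m St | present-partner m' St'
    ... | inj₁ (t~u , Su) | inj₁ (t'~u , _) = t≢t' (shared-partner unique₁ Su t~u t'~u)
    ... | inj₂ (t~u , Su) | inj₂ (t'~u , _) = t≢t' (shared-partner unique₂ Su t~u t'~u)
    ... | inj₁ (_ , Su₁) | inj₂ (_ , Su₂) = [ true≢false Su₁ , true≢false Su₂ ] absent
    ... | inj₂ (_ , Su₂) | inj₁ (_ , Su₁) = [ true≢false Su₁ , true≢false Su₂ ] absent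

    -- M pairs the present a's with the present b's, so unequal counts leave a present triple
    -- with no partner available (stranded) or sharing one with another (crowded).
    annihilates-square : ∀ {a₁ a₂ b₁ b₂} → a₁ ≢ a₂ → b₁ ≢ b₂ →
      Matched a₁ b₁ b₂ → Matched a₂ b₁ b₂ → Matched b₁ a₁ a₂ → Matched b₂ a₁ a₂ →
      pairSum (pos a₁ ∷ pos a₂ ∷ neg b₁ ∷ neg b₂ ∷ []) S ≡ 0ℤ
    annihilates-square {a₁} {a₂} {b₁} {b₂} a₁≢a₂ b₁≢b₂ ma₁ ma₂ mb₁ mb₂ = cases _ _ _ _ refl refl refl refl
      where
      crowded-a = crowded a₁≢a₂ ma₁ ma₂ (proj₁ mb₁) (proj₁ mb₂)
      crowded-b = crowded b₁≢b₂ mb₁ mb₂ (proj₁ ma₁) (proj₁ ma₂)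
      cases : ∀ x₁ x₂ y₁ y₂ → S a₁ ≡ x₁ → S a₂ ≡ x₂ → S b₁ ≡ y₁ → S b₂ ≡ y₂ →
              1ℤ * χ x₁ + (1ℤ * χ x₂ + (-1ℤ * χ y₁ + (-1ℤ * χ y₂ + 0ℤ))) ≡ 0ℤ
      cases true  true  true  true  _ _ _ _ = refl
      cases true  false true  false _ _ _ _ = refl
      cases true  false false true  _ _ _ _ = refl
      cases false true  true  false _ _ _ _ = refl
      cases false true  false true  _ _ _ _ = refl
      cases false false false false _ _ _ _ = refl
      cases true  true  true  false e₁ e₂ _  e₄ = ⊥-elim (crowded-a e₁ e₂ (inj₂ e₄))
      cases true  true  false true  e₁ e₂ e₃ _  = ⊥-elim (crowded-a e₁ e₂ (inj₁ e₃))
      cases true  true  false false e₁ _  e₃ e₄ = ⊥-elim (stranded ma₁ e₁ e₃ e₄)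
      cases true  false false false e₁ _  e₃ e₄ = ⊥-elim (stranded ma₁ e₁ e₃ e₄)
      cases false true  false false _  e₂ e₃ e₄ = ⊥-elim (stranded ma₂ e₂ e₃ e₄)
      cases true  false true  true  _  e₂ e₃ e₄ = ⊥-elim (crowded-b e₃ e₄ (inj₂ e₂))
      cases false true  true  true  e₁ _  e₃ e₄ = ⊥-elim (crowded-b e₃ e₄ (inj₁ e₁))
      cases false false true  true  e₁ e₂ e₃ _  = ⊥-elim (stranded mb₁ e₃ e₁ e₂)
      cases false false true  false e₁ e₂ e₃ _  = ⊥-elim (stranded mb₁ e₃ e₁ e₂)
      cases false false false true  e₁ e₂ _  e₄ = ⊥-elim (stranded mb₂ e₄ e₁ e₂)

    annihilates-edge : ∀ {a b} → Matched a b a → Matched b a b → pairSum (pos a ∷ neg b ∷ []) S ≡ 0ℤ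
    annihilates-edge {a} {b} ma mb = cases _ _ refl refl
      where
      partner-present : ∀ {t u} → Matched t u t → S t ≡ true → S u ≡ true
      partner-present m St with present-partner m St
      ... | inj₁ (_ , Su) = Su
      ... | inj₂ (t~t , _) = ⊥-elim (switch-irrefl (switch t~t))
      cases : ∀ x y → S a ≡ x → S b ≡ y → 1ℤ * χ x + (-1ℤ * χ y + 0ℤ) ≡ 0ℤ
      cases true  true  _ _ = refl
      cases false false _ _ = refl
      cases true  false Sa Sb = ⊥-elim (true≢false (partner-present ma Sa) Sb)
      cases false true  Sa Sb = ⊥-elim (true≢false (partner-present mb Sb) Sa)

    matched : ∀ {p q r u₁ u₂} → OneDescent p q r →
              knuthPartner (p ∷ q ∷ r ∷ []) ≡ u₁ → otherPartner (p ∷ q ∷ r ∷ []) ≡ u₂ → Matched (p ∷ q ∷ r ∷ []) u₁ u₂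
    matched one k≡u₁ o≡u₂ = unique-partner one , switchPartnersAmong k≡u₁ o≡u₂

    matched-swap : ∀ {t u₁ u₂} → Matched t u₁ u₂ → Matched t u₂ u₁
    matched-swap (unique , among) = unique , switchPartnersAmong-swap among

    localSwitchboard⇒annihilates : AnnihilatesGenerators S
    localSwitchboard⇒annihilates (gen-three a b c a<b b<c) =
      annihilates-square (∷-≢ˡ (≢-sym (FinP.<⇒≢ a<b))) (∷-≢ˡ (FinP.<⇒≢ b<c))
        (matched (inj₂ (FinP.<-asym b<c , a<c)) knuth-bca other-bca)
        (matched-swap (matched (inj₂ (FinP.<-asym a<c , b<c)) knuth-acb other-acb))
        (matched (inj₁ (a<b , FinP.<-asym a<c)) knuth-bac other-bac)
        (matched-swap (matched (inj₁ (a<c , FinP.<-asym a<b)) knuth-cab other-cab))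
      where open DistinctLetters a<b b<c
    localSwitchboard⇒annihilates (gen-adj a b adj) =
      annihilates-square (∷-≢ˡ (≢-sym (FinP.<⇒≢ a<b))) (∷-≢ʳ (∷-≢ʳ (∷-≢ˡ (≢-sym (FinP.<⇒≢ a<b)))))
        (matched (inj₂ (FinP.<-irrefl refl , a<b)) knuth-bba other-bba)
        (matched-swap (matched (inj₂ (FinP.<-asym a<b , a<b)) knuth-aba other-aba))
        (matched (inj₁ (a<b , FinP.<-asym a<b)) knuth-bab other-bab)
        (matched-swap (matched (inj₁ (a<b , FinP.<-irrefl refl)) knuth-baa other-baa))
      where
      a<b = adjacent⇒< adj
      open RepeatedLetter a<b
      open AdjacentLetters adj
    localSwitchboard⇒annihilates (gen-far₁ a b far) =
      annihilates-edge
        (matched (inj₂ (FinP.<-irrefl refl , a<b)) knuth-bba other-bba)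
        (matched (inj₁ (a<b , FinP.<-asym a<b)) knuth-bab other-bab)
      where
      a<b = distant⇒< far
      open RepeatedLetter a<b
      open DistantLetters far
    localSwitchboard⇒annihilates (gen-far₂ a b far) =
      annihilates-edge
        (matched (inj₁ (a<b , FinP.<-irrefl refl)) knuth-baa other-baa)
        (matched (inj₂ (FinP.<-asym a<b , a<b)) knuth-aba other-aba)
      where
      a<b = distant⇒< far
      open RepeatedLetter a<b
      open DistantLetters far

-- Gluing the slices

++-cancel-length : ∀ {A : Set} (x x' : List A) {s s'} → length x ≡ length x' → x ++ s ≡ x' ++ s' → x ≡ x' × s ≡ s'
++-cancel-length []      []        _ eq = refl , eq
++-cancel-length (a ∷ x) (a' ∷ x') |x|≡|x'| eq with refl , eq' ← ListP.∷-injective eq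
                                               with refl , s≡s' ← ++-cancel-length x x' (ℕP.suc-injective |x|≡|x'|) eq'
  = refl , s≡s'

++-cancel-lengths : ∀ {A : Set} {x x' t t' y y' : List A} → length x ≡ length x' → length t ≡ length t' →
                    x ++ t ++ y ≡ x' ++ t' ++ y' → x ≡ x' × t ≡ t' × y ≡ y'
++-cancel-lengths {x = x} {x'} {t} {t'} |x|≡|x'| |t|≡|t'| eq
  with refl , eq' ← ++-cancel-length x x' |x|≡|x'| eq
  with refl , refl ← ++-cancel-length t t' |t|≡|t'| eq'
  = refl , refl , refl

middle-cancel : ∀ {A : Set} (x y : List A) {s s'} → x ++ s ++ y ≡ x ++ s' ++ y → s ≡ s'
middle-cancel x y {s} {s'} eq = ListP.++-cancelʳ y s s' (ListP.++-cancelˡ x (s ++ y) (s' ++ y) eq)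

triple-at : ∀ {A : Set} k (w : List A) → 3 ℕ.+ k ≤ length w →
           Σ (List A) λ x → Σ A λ p → Σ A λ q → Σ A λ r → Σ (List A) λ y → w ≡ x ++ p ∷ q ∷ r ∷ y × length x ≡ k
triple-at zero    (p ∷ q ∷ r ∷ y) _ = [] , p , q , r , y , refl , refl
triple-at zero    (_ ∷ _ ∷ []) (s≤s (s≤s ()))
triple-at zero    (_ ∷ []) (s≤s ())
triple-at (suc k) (a ∷ w) (s≤s 3+k≤|w|) with x , p , q , r , y , refl , refl ← triple-at k w 3+k≤|w|
  = a ∷ x , p , q , r , y , refl , refl

module _ {N : ℕ} where

  descent-at : ∀ (x : Word N) c d y → Descent (x ++ c ∷ d ∷ y) (suc (length x)) ⇔ d < c
  descent-at x c d y = mk⇔ to (λ d<c → x , c , d , y , refl , refl , d<c)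
    where
    to : Descent (x ++ c ∷ d ∷ y) (suc (length x)) → d < c
    to (x' , c' , d' , y' , eq , 1+|x'|≡1+|x| , d'<c')
      with refl , eq' ← ++-cancel-length x x' (sym (ℕP.suc-injective 1+|x'|≡1+|x|)) eq
      with refl ← eq'
      = d'<c'

  descent-at-second : ∀ (x : Word N) p q r y → Descent (x ++ p ∷ q ∷ r ∷ y) (suc (suc (length x))) ⇔ r < q
  descent-at-second x p q r y =
    subst₂ (λ w i → Descent w i ⇔ r < q) (ListP.∷ʳ-++ x p (q ∷ r ∷ y)) (cong suc |x∷ʳp|≡1+|x|) (descent-at (x ∷ʳ p) q r y)
    where
    |x∷ʳp|≡1+|x| : length (x ∷ʳ p) ≡ suc (length x)
    |x∷ʳp|≡1+|x| = trans (ListP.length-++ x) (ℕP.+-comm (length x) 1)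

  exactlyOneDescent⇔oneDescent : ∀ (x : Word N) p q r y →
    ExactlyOneDescent (x ++ p ∷ q ∷ r ∷ y) (suc (suc (length x))) ⇔ OneDescent p q r
  exactlyOneDescent⇔oneDescent x p q r y = mk⇔
    (Sum.map (Product.map first.to (λ ¬d₂ r<q → ¬d₂ (second.from r<q)))
             (Product.map (λ ¬d₁ q<p → ¬d₁ (first.from q<p)) second.to))
    (Sum.map (Product.map first.from (λ r≮q d₂ → r≮q (second.to d₂)))
             (Product.map (λ q≮p d₁ → q≮p (first.to d₁)) second.from))
    where
    module first = Equivalence (descent-at x p q (r ∷ y))
    module second = Equivalence (descent-at-second x p q r y)

  position-bound : ∀ (x t y : Word N) → length t ≡ 3 → 3 ℕ.+ length x ≤ length (x ++ t ++ y)
  position-bound x t y |t|≡3 = begin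
    3 ℕ.+ length x                    ≡⟨ ℕP.+-comm 3 (length x) ⟩
    length x ℕ.+ 3                    ≤⟨ ℕP.+-monoʳ-≤ (length x) (ℕP.m≤m+n 3 (length y)) ⟩
    length x ℕ.+ (3 ℕ.+ length y)     ≡⟨ cong (λ l → length x ℕ.+ (l ℕ.+ length y)) |t|≡3 ⟨
    length x ℕ.+ (length t ℕ.+ length y) ≡⟨ cong (length x ℕ.+_) (ListP.length-++ t) ⟨
    length x ℕ.+ length (t ++ y)      ≡⟨ ListP.length-++ x ⟨
    length (x ++ t ++ y)              ∎
    where open ℕP.≤-Reasoning

  GluedEdge : (Word N → Word N → Word N → Word N → Set) → Word N → Word N → ℕ → Set
  GluedEdge M w w' i = Σ (Word N) λ x → Σ (Word N) λ y → Σ (Word N) λ t → Σ (Word N) λ t' →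
    w ≡ x ++ t ++ y × w' ≡ x ++ t' ++ y × suc (suc (length x)) ≡ i × M x y t t'

  module _ (n : ℕ) (W : Word N → Bool) (len : ∀ w → W w ≡ true → length w ≡ n) where

    glue : (M : Word N → Word N → Word N → Word N → Set) → (∀ x y → LocalSwitchboard (slice W x y) (M x y)) →
           IsSwitchboard n W (GluedEdge M)
    glue M local = record
      { edge-vertexˡ = λ { (x , y , _ , _ , refl , _ , _ , m) → member (local x y) (symmetric (local x y) m) }
      ; edge-vertexʳ = λ { (x , y , _ , _ , _ , refl , _ , m) → member (local x y) m }
      ; edge-sym     = λ (x , y , t , t' , w≡ , w'≡ , i≡ , m) → x , y , t' , t , w'≡ , w≡ , i≡ , symmetric (local x y) m
      ; label-lo     = λ { (_ , _ , _ , _ , _ , _ , refl , _) → s≤s (s≤s z≤n) }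
      ; label-hi     = label-hi
      ; edge-switch  = λ (x , y , t , t' , w≡ , w'≡ , i≡ , m) →
                         x , y , t , t' , w≡ , w'≡ , trans (ℕP.+-comm (length x) 2) i≡ , switch (local x y) m
      ; exactly-one  = exactly-one
      }
      where
      open LocalSwitchboard

      label-hi : ∀ {w w' i} → GluedEdge M w w' i → suc i ≤ n
      label-hi (x , y , t , t' , refl , _ , refl , m) =
        subst (3 ℕ.+ length x ≤_) (len _ (member (local x y) (symmetric (local x y) m)))
              (position-bound x t y (proj₁ (switch-length (switch (local x y) m))))

      exactly-one : ∀ w i → W w ≡ true → 2 ≤ i → suc i ≤ n → ExactlyOneDescent w i → ∃! _≡_ (λ w' → GluedEdge M w w' i)
      exactly-one w (suc (suc k)) Ww (s≤s (s≤s z≤n)) 3+k≤n one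
        with x , p , q , r , y , refl , refl ← triple-at k w (subst (3 ℕ.+ k ≤_) (sym (len w Ww)) 3+k≤n)
        with t' , m , only ← unique-partner (local x y) (Equivalence.to (exactlyOneDescent⇔oneDescent x p q r y) one) Ww
        = x ++ t' ++ y , (x , y , p ∷ q ∷ r ∷ [] , t' , refl , refl , refl , m) , glued-only
        where
        glued-only : ∀ {w''} → GluedEdge M (x ++ p ∷ q ∷ r ∷ y) w'' (suc (suc (length x))) → x ++ t' ++ y ≡ w''
        glued-only (x₂ , y₂ , t₂ , t₂' , w≡ , refl , i≡ , m₂)
          with refl , refl , refl ← ++-cancel-lengths {x = x} {x₂} {p ∷ q ∷ r ∷ []} {t₂} {y} {y₂} (ℕP.suc-injective (ℕP.suc-injective (sym i≡)))
                                      (sym (proj₁ (switch-length (switch (local x₂ y₂) m₂)))) w≡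
          = cong (λ s → x ++ s ++ y) (only m₂)

    module _ {E : Word N → Word N → ℕ → Set} (sb : IsSwitchboard n W E) where
      open IsSwitchboard sb

      SliceEdge : Word N → Word N → Word N → Word N → Set
      SliceEdge x y t t' = length t ≡ 3 × E (x ++ t ++ y) (x ++ t' ++ y) (suc (suc (length x)))

      edge-at-triple : ∀ {x y t w'} → length t ≡ 3 → E (x ++ t ++ y) w' (suc (suc (length x))) →
                       Σ (Word N) λ t' → w' ≡ x ++ t' ++ y × SwitchTriple t t'
      edge-at-triple {x} {y} {t} |t|≡3 e
        with x' , y' , t₀ , t₀' , w≡ , w'≡ , i≡ , t₀⇄t₀' ← edge-switch e
        with refl , refl , refl ← ++-cancel-lengths {x = x} {x'} {t} {t₀} {y} {y'}
               (sym (ℕP.suc-injective (ℕP.suc-injective (trans (ℕP.+-comm 2 (length x')) i≡))))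
               (trans |t|≡3 (sym (proj₁ (switch-length t₀⇄t₀')))) w≡
        = t₀' , w'≡ , t₀⇄t₀'

      restrict-to-slice : ∀ x y → LocalSwitchboard (slice W x y) (SliceEdge x y)
      restrict-to-slice x y = record
        { switch         = switch
        ; member         = λ (_ , e) → edge-vertexʳ e
        ; symmetric      = λ (|t|≡3 , e) → proj₂ (switch-length (switch (|t|≡3 , e))) , edge-sym e
        ; unique-partner = unique-partner
        }
        where
        switch : ∀ {t t'} → SliceEdge x y t t' → SwitchTriple t t'
        switch (|t|≡3 , e) with t₀' , w'≡ , t⇄t₀' ← edge-at-triple {x} {y} |t|≡3 e
          rewrite middle-cancel x y w'≡ = t⇄t₀'

        unique-partner : ∀ {p q r} → OneDescent p q r → slice W x y (p ∷ q ∷ r ∷ []) ≡ true →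
                         ∃! _≡_ (SliceEdge x y (p ∷ q ∷ r ∷ []))
        unique-partner {p} {q} {r} one Sw
          with w' , e , only ← exactly-one (x ++ p ∷ q ∷ r ∷ y) (suc (suc (length x))) Sw (s≤s (s≤s z≤n))
                                 (subst (3 ℕ.+ length x ≤_) (len _ Sw) (position-bound x (p ∷ q ∷ r ∷ []) y refl))
                                 (Equivalence.from (exactlyOneDescent⇔oneDescent x p q r y) one)
          with t' , refl , _ ← edge-at-triple {x} {y} refl e
          = t' , (refl , e) , λ (_ , e'') → middle-cancel x y (only e'')

proposition3p3 : (N n : ℕ) (W : Word N → Bool) →
    (∀ w → W w ≡ true → length w ≡ n) →
    SumInISPerp W ⇔ IsSwitchboardVertexSet n W
proposition3p3 N n W len = mk⇔
  (λ W⊥ → GluedEdge (λ x y → LocalEdge (slice W x y)) ,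
          glue n W len _ (λ x y → annihilates⇒localSwitchboard (perp⇒slicesAnnihilate W W⊥ x y)))
  (λ (E , sb) → slicesAnnihilate⇒perp W (λ x y → localSwitchboard⇒annihilates (restrict-to-slice n W len sb x y)))
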